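{- Let $M$ be a grid graph with at least three rows (and at least three columns), with positive integer node weights, and let $s,t$ be nodes of $M$ such that $\{s,t\}$ is not a 2-cut of $M$. Then every minimum-weight $st$-NSC $B$ of $M$ is a non-separating induced $st$-path.
   Context: An $m\times n$ grid graph has node set $\{M_{ij}: 1\leq i\leq m,\ 1\leq j\leq n\}$, with an edge between two nodes consecutive in the same row or the same column. A set $\{s,t\}$ of two nodes is a 2-cut if deleting $s$ and $t$ disconnects the graph. An $st$-NSC (non-separating $st$-connector) is a connected subgraph $B$ containing $s$ and $t$ such that $M-V(B)$ is connected (and nonempty); its weight is the sum of weights of its nodes. A path $P$ is induced if the subgraph induced by $V(P)$ is $P$ itself; it is non-separating if $M-V(P)$ is connected. -}

module Defs where

open import Data.Nat using (ℕ; zero; suc; _≤_; _<_)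
open import Data.Fin using (Fin; toℕ; fromℕ; inject₁)
open import Data.Bool using (Bool; true; false; if_then_else_)
open import Data.List using (List; map; allFin)
open import Data.Nat.ListAction using (sum)
open import Data.Product using (Σ; ∃; _×_; _,_)
open import Data.Sum using (_⊎_)
open import Relation.Binary.PropositionalEquality using (_≡_; _≢_)
open import Relation.Nullary using (¬_)
open import Function.Definitions using (Injective)

-- Nodes of the m × n grid graph: M_ij with i a row index, j a column index.
Node : ℕ → ℕ → Set
Node m n = Fin m × Fin n

Consec : ∀ {k} → Fin k → Fin k → Set
Consec a b = suc (toℕ a) ≡ toℕ b ⊎ suc (toℕ b) ≡ toℕ a

Adj : ∀ {m n} → Node m n → Node m n → Set
Adj (i , j) (i' , j') = (i ≡ i' × Consec j j') ⊎ (j ≡ j' × Consec i i')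

data Walk {A : Set} (P : A → Set) (R : A → A → Set) : A → A → Set where
  here : ∀ {u} → P u → Walk P R u u
  step : ∀ {u v w} → P u → R u v → Walk P R v w → Walk P R u w

Connected : {A : Set} → (A → Set) → (A → A → Set) → Set
Connected {A} P R = (u v : A) → P u → P v → Walk P R u v

record Subgraph (m n : ℕ) : Set where
  field
    V : Node m n → Bool
    E : Node m n → Node m n → Bool
    E-sym : ∀ u v → E u v ≡ true → E v u ≡ true
    E-adj : ∀ u v → E u v ≡ true → Adj u v
    E-V   : ∀ u v → E u v ≡ true → V u ≡ true × V v ≡ true
open Subgraph public

InV : ∀ {m n} → Subgraph m n → Node m n → Set
InV B x = V B x ≡ true

EdgeOf : ∀ {m n} → Subgraph m n → Node m n → Node m n → Set
EdgeOf B u v = E B u v ≡ true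

SubConnected : ∀ {m n} → Subgraph m n → Set
SubConnected B = Connected (InV B) (EdgeOf B)

Outside : ∀ {m n} → (Node m n → Bool) → Node m n → Set
Outside X x = X x ≡ false

RestConnected : ∀ {m n} → (Node m n → Bool) → Set
RestConnected X = Connected (Outside X) Adj

TwoCut : ∀ {m n} → Node m n → Node m n → Set
TwoCut {m} {n} s t = ¬ Connected (λ x → x ≢ s × x ≢ t) (Adj {m} {n})

weightOf : ∀ {m n} → (Node m n → ℕ) → (Node m n → Bool) → ℕ
weightOf {m} {n} w X =
  sum (map (λ i → sum (map (λ j → if X (i , j) then w (i , j) else 0) (allFin n))) (allFin m))

weight : ∀ {m n} → (Node m n → ℕ) → Subgraph m n → ℕ
weight w B = weightOf w (V B)

IsNSC : ∀ {m n} → Node m n → Node m n → Subgraph m n → Set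
IsNSC {m} {n} s t B =
  SubConnected B × InV B s × InV B t
  × RestConnected (V B) × Σ (Node m n) (λ x → Outside (V B) x)

IsMinNSC : ∀ {m n} → (Node m n → ℕ) → Node m n → Node m n → Subgraph m n → Set
IsMinNSC {m} {n} w s t B =
  IsNSC s t B × ((B' : Subgraph m n) → IsNSC s t B' → weight w B ≤ weight w B')

IsPath : ∀ {m n} → Node m n → Node m n → Subgraph m n → Set
IsPath {m} {n} s t B =
  Σ ℕ λ k → Σ (Fin (suc k) → Node m n) λ x →
    Injective _≡_ _≡_ x
    × x Fin.zero ≡ s × x (fromℕ k) ≡ t
    × (∀ u → InV B u → Σ (Fin (suc k)) λ i → x i ≡ u)
    × (∀ i → InV B (x i))
    × (∀ u v → EdgeOf B u v →
         Σ (Fin k) λ i → (x (inject₁ i) ≡ u × x (Fin.suc i) ≡ v)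
                        ⊎ (x (inject₁ i) ≡ v × x (Fin.suc i) ≡ u))
    × (∀ (i : Fin k) → EdgeOf B (x (inject₁ i)) (x (Fin.suc i)))

IsInduced : ∀ {m n} → Subgraph m n → Set
IsInduced B = ∀ u v → InV B u → InV B v → Adj u v → EdgeOf B u v

NonSeparating : ∀ {m n} → Subgraph m n → Set
NonSeparating B = RestConnected (V B)

{-# OPTIONS --safe #-}
module Submission where

-- Call a node z of B other than s and t bypassed if s and t stay connected in B - z.  By
-- minimality a bypassed node has no neighbour outside B.  Let U be a component of the
-- bypassed nodes.  The nodes adjacent to U are unbypassed nodes of B, so they lie on every
-- st-path in B, and at most two nodes a, b can be adjacent to U: of three, the middle one
-- would be bypassed through U.  So {a , b} separates U from the complement of B.  In a grid
-- a pair can only cut off a single corner, and this is not the complement of B because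
-- {s , t} is not a 2-cut.  Hence every bypassed node is a corner with two unbypassed
-- neighbours.  A node of B off a given simple st-path, or a chord of that path, would
-- produce a bypassed node on the path that contradicts this.

open import Defs
open import Data.Nat using (ℕ; zero; suc; _+_; _∸_; _≤_; _<_; z≤n; s≤s; s≤s⁻¹; _≤′_; ≤′-refl; ≤′-step)
open import Data.Nat.Properties
open import Data.Nat.ListAction using (sum)
open import Data.Fin as Fin using (Fin; toℕ; inject₁)
open import Data.Fin.Properties using (toℕ-inject₁; toℕ-injective; toℕ-fromℕ; toℕ<n; toℕ-fromℕ<)
open import Data.Bool using (Bool; true; false; if_then_else_; not)
open import Data.Bool.Properties using (not-involutive; not-¬)
open import Data.List using (_∷_; []; map; allFin)
open import Data.List.Membership.Propositional using (_∈_)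
open import Data.List.Membership.Propositional.Properties using (∈-allFin)
open import Data.List.Relation.Unary.Any as Any using ()
open import Data.Product using (Σ; ∃; ∃₂; _×_; _,_; proj₁; proj₂)
open import Data.Product.Properties using (≡-dec)
open import Data.Sum as Sum using (_⊎_; inj₁; inj₂; [_,_]′)
open import Data.Empty using (⊥; ⊥-elim)
open import Data.Unit using (⊤; tt)
open import Relation.Binary.Definitions using (DecidableEquality; tri<; tri≈; tri>)
open import Relation.Binary.PropositionalEquality using (_≡_; _≢_; refl; sym; trans; cong; subst; subst₂)
open import Relation.Nullary using (¬_; Dec; yes; no; does)
open import Relation.Nullary.Decidable using (¬¬-excluded-middle; decidable-stable; _×-dec_; _⊎-dec_; dec-true; dec-false)

-- Finite case distinctions under double negation.

¬¬-∀-Fin : ∀ {n} {P : Fin n → Set} → (∀ i → ¬ ¬ P i) → ¬ ¬ (∀ i → P i)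
¬¬-∀-Fin {zero}  f k = k λ ()
¬¬-∀-Fin {suc n} f k =
  f Fin.zero λ p → ¬¬-∀-Fin (λ i → f (Fin.suc i)) λ q →
    k λ { Fin.zero → p ; (Fin.suc i) → q i }

-- There are finitely many nodes, so double negation commutes with the quantifier. When the goal is
-- a negation, predicates such as reachability may thus be treated as decidable.
¬¬-decide : ∀ {m n} (P : Node m n → Set) → ¬ ¬ (∀ x → Dec (P x))
¬¬-decide P k =
  ¬¬-∀-Fin (λ i → ¬¬-∀-Fin (λ j → ¬¬-excluded-middle {A = P (i , j)}))
    λ d → k λ { (i , j) → d i j }

-- If `Q` has fewer than two elements, the pair is padded with a repeated element or with the
-- default `d`; `S` is what the padding must satisfy as well.
¬¬-atMostTwo : {A : Set} (Q : A → Set) → DecidableEquality A → ∀ {d} {S : A → Set} →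
  S d → (∀ {y} → Q y → S y) →
  (∀ {a b c} → Q a → Q b → Q c → a ≢ b → a ≢ c → b ≢ c → ⊥) →
  ¬ ¬ (∃₂ λ a b → S a × S b × (∀ y → Q y → y ≡ a ⊎ y ≡ b))
¬¬-atMostTwo {A} Q _≟_ {d} {S} Sd Q⇒S no3 k = ¬¬-excluded-middle none-or-some
  where
  third : ∀ {a b y} → Q a → Q b → b ≢ a → Q y → y ≡ a ⊎ y ≡ b
  third {a} {b} {y} Qa Qb b≢a q with y ≟ a | y ≟ b
  ... | yes e | _     = inj₁ e
  ... | no _  | yes e = inj₂ e
  ... | no y≢a | no y≢b = ⊥-elim (no3 q Qa Qb y≢a y≢b λ e → b≢a (sym e))

  one-or-two : ∀ {a} → Q a → ¬ Dec (∃ λ y → Q y × y ≢ a)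
  one-or-two {a} Qa (no ¬∃) = k (a , a , Q⇒S Qa , Q⇒S Qa , λ y q →
    inj₁ (decidable-stable (y ≟ a) λ y≢a → ¬∃ (y , q , y≢a)))
  one-or-two {a} Qa (yes (b , Qb , b≢a)) =
    k (a , b , Q⇒S Qa , Q⇒S Qb , λ y q → third Qa Qb b≢a q)

  none-or-some : ¬ Dec (∃ Q)
  none-or-some (no ¬∃)        = k (d , d , Sd , Sd , λ y q → ⊥-elim (¬∃ (y , q)))
  none-or-some (yes (a , Qa)) = ¬¬-excluded-middle (one-or-two Qa)

-- Walks and simple paths.

module _ {A : Set} {P : A → Set} {R : A → A → Set} where

  walk-start : ∀ {u v} → Walk P R u v → P u
  walk-start (here p)     = p
  walk-start (step p _ _) = p

  walk-end : ∀ {u v} → Walk P R u v → P v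
  walk-end (here p)     = p
  walk-end (step _ _ q) = walk-end q

  infixr 5 _◅◅_
  _◅◅_ : ∀ {u v w} → Walk P R u v → Walk P R v w → Walk P R u w
  here _     ◅◅ q = q
  step p r t ◅◅ q = step p r (t ◅◅ q)

  walk-reverse : (∀ {u v} → R u v → R v u) → ∀ {u v} → Walk P R u v → Walk P R v u
  walk-reverse R-sym (here p) = here p
  walk-reverse R-sym (step p r q) =
    walk-reverse R-sym q ◅◅ step (walk-start q) (R-sym r) (here p)

walk-map : ∀ {A A' : Set} {P : A → Set} {R : A → A → Set} {P' : A' → Set} {R' : A' → A' → Set}
  (f : A → A') → (∀ {u} → P u → P' (f u)) → (∀ {u v} → P u → P v → R u v → R' (f u) (f v)) →
  ∀ {u v} → Walk P R u v → Walk P' R' (f u) (f v)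
walk-map f pf rf (here p)     = here (pf p)
walk-map f pf rf (step p r q) = step (pf p) (rf p (walk-start q) r) (walk-map f pf rf q)

-- Positions are natural numbers, with `at` constrained only up to `len`, so that cutting and
-- splicing need only order arithmetic.
record SimplePath {A : Set} (P : A → Set) (R : A → A → Set) (s t : A) : Set where
  field
    len    : ℕ
    at     : ℕ → A
    first  : at 0 ≡ s
    last   : at len ≡ t
    inside : ∀ {i} → i ≤ len → P (at i)
    edge   : ∀ {i} → i < len → R (at i) (at (suc i))
    inj    : ∀ {i j} → i ≤ len → j ≤ len → at i ≡ at j → i ≡ j

-- If the start already occurs on the erased tail, at index `i`, only the part from `i` on is kept;
-- otherwise the start is prepended.
loopErase : ∀ {A : Set} {P : A → Set} {R : A → A → Set} → DecidableEquality A →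
  ∀ {s t} → Walk P R s t → SimplePath P R s t
loopErase _≟_ {s} (here p) = record
  { len = 0 ; at = λ _ → s ; first = refl ; last = refl ; inside = λ _ → p
  ; edge = λ () ; inj = λ { z≤n z≤n _ → refl } }
loopErase {P = P} {R} _≟_ {s} (step p r q)
  with Q ← loopErase _≟_ q
  with anyUpTo? (λ i → SimplePath.at Q i ≟ s) (suc (SimplePath.len Q))
... | yes (i , i<1+k , e) = record
  { len = len ∸ i ; at = λ l → at (i + l)
  ; first = trans (cong at (+-identityʳ i)) e
  ; last = trans (cong at (m+[n∸m]≡n i≤k)) last
  ; inside = λ le → inside (bound le)
  ; edge = λ {l} lt → subst (λ h → R (at (i + l)) (at h)) (sym (+-suc i l))
                        (edge (subst (_≤ len) (+-suc i l) (bound lt)))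
  ; inj = λ le le' eq → +-cancelˡ-≡ i _ _ (inj (bound le) (bound le') eq) }
  where
  open SimplePath Q
  i≤k : i ≤ len
  i≤k = s≤s⁻¹ i<1+k
  bound : ∀ {l} → l ≤ len ∸ i → i + l ≤ len
  bound le = ≤-trans (+-monoʳ-≤ i le) (≤-reflexive (m+[n∸m]≡n i≤k))
... | no s∉Q = record
  { len = suc len ; at = at' ; first = refl ; last = last
  ; inside = λ { {zero} _ → p ; {suc i} le → inside (s≤s⁻¹ le) }
  ; edge = λ { {zero} _ → subst (R s) (sym first) r ; {suc i} lt → edge (s≤s⁻¹ lt) }
  ; inj = inj' }
  where
  open SimplePath Q
  at' : ℕ → _
  at' zero    = s
  at' (suc l) = at l
  inj' : ∀ {i j} → i ≤ suc len → j ≤ suc len → at' i ≡ at' j → i ≡ j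
  inj' {zero}  {zero}  _ _ _ = refl
  inj' {zero}  {suc j} _ le e = ⊥-elim (s∉Q (j , le , sym e))
  inj' {suc i} {zero}  le _ e = ⊥-elim (s∉Q (i , le , e))
  inj' {suc i} {suc j} le le' e = cong suc (inj (s≤s⁻¹ le) (s≤s⁻¹ le') e)

-- Strict monotonicity of the weight.

sum-map-mono : ∀ {A : Set} (f g : A → ℕ) → (∀ x → f x ≤ g x) →
  ∀ xs → sum (map f xs) ≤ sum (map g xs)
sum-map-mono f g f≤g []       = z≤n
sum-map-mono f g f≤g (x ∷ xs) = +-mono-≤ (f≤g x) (sum-map-mono f g f≤g xs)

sum-map-mono-< : ∀ {A : Set} (f g : A → ℕ) → (∀ x → f x ≤ g x) →
  ∀ {z xs} → z ∈ xs → f z < g z → sum (map f xs) < sum (map g xs)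
sum-map-mono-< f g f≤g {xs = _ ∷ xs} (Any.here refl) fz<gz =
  +-mono-<-≤ fz<gz (sum-map-mono f g f≤g xs)
sum-map-mono-< f g f≤g (Any.there z∈xs) fz<gz =
  +-mono-≤-< (f≤g _) (sum-map-mono-< f g f≤g z∈xs fz<gz)

weightOf-mono-< : ∀ {m n} (w : Node m n → ℕ) (X Y : Node m n → Bool) →
  (∀ x → X x ≡ true → Y x ≡ true) →
  ∀ z → X z ≡ false → Y z ≡ true → 0 < w z → weightOf w X < weightOf w Y
weightOf-mono-< {m} {n} w X Y X⊆Y z@(i₀ , j₀) z∉X z∈Y 0<wz =
  sum-map-mono-< _ _ (λ i → sum-map-mono _ _ (λ j → pointwise (i , j)) (allFin n))
    (∈-allFin i₀)
    (sum-map-mono-< _ _ (λ j → pointwise (i₀ , j)) (∈-allFin j₀) strict)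
  where
  pointwise : ∀ x → (if X x then w x else 0) ≤ (if Y x then w x else 0)
  pointwise x with X x in eq
  ... | false = z≤n
  ... | true rewrite X⊆Y x eq = ≤-refl
  strict : (if X z then w z else 0) < (if Y z then w z else 0)
  strict rewrite z∉X | z∈Y = 0<wz

-- Adjacency in the grid and its lines.

_≟ₙ_ : ∀ {m n} → DecidableEquality (Node m n)
_≟ₙ_ = ≡-dec Fin._≟_ Fin._≟_

Adj-sym : ∀ {m n} {u v : Node m n} → Adj u v → Adj v u
Adj-sym = Sum.map (λ { (e , c) → sym e , Sum.swap c }) (λ { (e , c) → sym e , Sum.swap c })

Consec-irrefl : ∀ {k} {a b : Fin k} → Consec a b → a ≢ b
Consec-irrefl (inj₁ e) refl = 1+n≢n e
Consec-irrefl (inj₂ e) refl = 1+n≢n e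

Adj-irrefl : ∀ {m n} {u v : Node m n} → Adj u v → u ≢ v
Adj-irrefl (inj₁ (_ , c)) e = Consec-irrefl c (cong proj₂ e)
Adj-irrefl (inj₂ (_ , c)) e = Consec-irrefl c (cong proj₁ e)

neighbour : ∀ {k} (i : Fin (2 + k)) → ∃ (Consec i)
neighbour Fin.zero    = Fin.suc Fin.zero , inj₁ refl
neighbour (Fin.suc i) = inject₁ i , inj₂ (cong suc (toℕ-inject₁ i))

-- On a line of at least three nodes, two consecutive nodes are not both ends.
thirdInLine : ∀ {k} {j j' : Fin (3 + k)} → Consec j j' →
  (∃ λ l → Consec j l × l ≢ j') ⊎ (∃ λ l → Consec j' l × l ≢ j)
thirdInLine (inj₁ e) = ascending e
  where
  ascending : ∀ {k} {j j' : Fin (3 + k)} → suc (toℕ j) ≡ toℕ j' →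
    (∃ λ l → Consec j l × l ≢ j') ⊎ (∃ λ l → Consec j' l × l ≢ j)
  ascending {j = Fin.zero} e = inj₂ (Fin.suc (Fin.suc Fin.zero) , inj₁ (cong suc (sym e)) , λ ())
  ascending {j = Fin.suc p} {j'} e = inj₁ (inject₁ p , inj₂ (cong suc (toℕ-inject₁ p)) , λ eq →
    m≢1+n+m (toℕ p) {1} (trans (trans (sym (toℕ-inject₁ p)) (cong toℕ eq)) (sym e)))
thirdInLine {j = j} {j'} (inj₂ e) = Sum.swap (thirdInLine {j = j'} {j} (inj₁ e))

avoidTwo : ∀ {k} (p q : Fin (3 + k)) → ∃ λ r → r ≢ p × r ≢ q
avoidTwo Fin.zero Fin.zero = Fin.suc Fin.zero , (λ ()) , λ ()
avoidTwo Fin.zero (Fin.suc Fin.zero) = Fin.suc (Fin.suc Fin.zero) , (λ ()) , λ ()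
avoidTwo Fin.zero (Fin.suc (Fin.suc _)) = Fin.suc Fin.zero , (λ ()) , λ ()
avoidTwo (Fin.suc Fin.zero) Fin.zero = Fin.suc (Fin.suc Fin.zero) , (λ ()) , λ ()
avoidTwo (Fin.suc (Fin.suc _)) Fin.zero = Fin.suc Fin.zero , (λ ()) , λ ()
avoidTwo (Fin.suc _) (Fin.suc _) = Fin.zero , (λ ()) , λ ()

lineWalk : ∀ {k} (i j : Fin k) → Walk (λ _ → ⊤) Consec i j
lineWalk {suc _} i j = walk-reverse Sum.swap (fromZero i) ◅◅ fromZero j
  where
  fromZero : ∀ {k} (i : Fin (suc k)) → Walk (λ _ → ⊤) Consec Fin.zero i
  fromZero Fin.zero = here tt
  fromZero {suc k} (Fin.suc i) =
    step tt (inj₁ refl) (walk-map Fin.suc (λ _ → tt) (λ _ _ → Sum.map (cong suc) (cong suc)) (fromZero i))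

Consec? : ∀ {k} (a b : Fin k) → Dec (Consec a b)
Consec? a b = (suc (toℕ a) ≟ toℕ b) ⊎-dec (suc (toℕ b) ≟ toℕ a)

Adj? : ∀ {m n} (u v : Node m n) → Dec (Adj u v)
Adj? (i , j) (i' , j') =
  ((i Fin.≟ i') ×-dec Consec? j j') ⊎-dec ((j Fin.≟ j') ×-dec Consec? i i')

does-true : ∀ {A : Set} (d : Dec A) → does d ≡ true → A
does-true (yes a) _ = a

induced : ∀ {m n} {P : Node m n → Set} → (∀ x → Dec (P x)) → Subgraph m n
induced P? = record
  { V = λ x → does (P? x)
  ; E = λ u v → does (edge? u v)
  ; E-sym = λ u v e → let (pu , pv , r) = does-true (edge? u v) e in
                      dec-true (edge? v u) (pv , pu , Adj-sym {u = u} {v} r)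
  ; E-adj = λ u v e → proj₂ (proj₂ (does-true (edge? u v) e))
  ; E-V   = λ u v e → let (pu , pv , _) = does-true (edge? u v) e in
                      dec-true (P? u) pu , dec-true (P? v) pv }
  where
  edge? : ∀ u v → Dec (_ × _ × Adj u v)
  edge? u v = P? u ×-dec P? v ×-dec Adj? u v

-- The chessboard colouring.

parity : ℕ → Bool
parity zero    = false
parity (suc n) = not (parity n)

parity-+ʳ : ∀ k l → parity (k + suc l) ≡ not (parity (k + l))
parity-+ʳ k l = cong parity (+-suc k l)

colour : ∀ {m n} → Node m n → Bool
colour (i , j) = parity (toℕ i + toℕ j)

Adj-colour : ∀ {m n} (u v : Node m n) → Adj u v → colour v ≡ not (colour u)
Adj-colour (i , j) (.i , j') (inj₁ (refl , inj₁ e)) rewrite sym e = parity-+ʳ (toℕ i) (toℕ j)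
Adj-colour (i , j) (.i , j') (inj₁ (refl , inj₂ e)) rewrite sym e | parity-+ʳ (toℕ i) (toℕ j') =
  sym (not-involutive _)
Adj-colour (i , j) (i' , .j) (inj₂ (refl , inj₁ e)) rewrite sym e = refl
Adj-colour (i , j) (i' , .j) (inj₂ (refl , inj₂ e)) rewrite sym e = sym (not-involutive _)

-- The grid is bipartite: `v` and `x` would both have the colour opposite to that of `u`.
noTriangle : ∀ {m n} (u v x : Node m n) → Adj u v → Adj v x → ¬ Adj u x
noTriangle u v x uv vx ux = not-¬ (trans (Adj-colour u x ux) (sym (Adj-colour u v uv)))
  (Adj-colour v x vx)

-- Pairs of nodes that separate a grid.

Off : ∀ {m n} → Node m n → Node m n → Node m n → Set
Off a b x = x ≢ a × x ≢ b

-- In a grid with at least three rows and columns, this makes `u` a corner with neighbours `a` and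
-- `b`.
Trapped : ∀ {m n} → Node m n → Node m n → Node m n → Set
Trapped a b u = ∀ y → Adj u y → y ≡ a ⊎ y ≡ b

rowWalk : ∀ {m n} {P : Node m n → Set} i → (∀ j → P (i , j)) →
  ∀ j j' → Walk P Adj (i , j) (i , j')
rowWalk i f j j' = walk-map (i ,_) (λ _ → f _) (λ _ _ c → inj₁ (refl , c)) (lineWalk j j')

colWalk : ∀ {m n} {P : Node m n → Set} j → (∀ i → P (i , j)) →
  ∀ i i' → Walk P Adj (i , j) (i' , j)
colWalk j f i i' = walk-map (_, j) (λ _ → f _) (λ _ _ c → inj₂ (refl , c)) (lineWalk i i')

-- A row and a column that miss both a and b meet in a hub.  A node outside {a , b} lies on
-- such a line, or a and b lie on its row and its column and then each of its remaining
-- neighbours lies on such a line.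
toHub : ∀ {p q} (a b : Node (3 + p) (3 + q)) → ∃ λ h → ∀ u → Off a b u →
  (∃ λ y → Adj u y × Off a b y) → Walk (Off a b) Adj u h
toHub {p} {q} a@(ra , ca) b@(rb , cb) with avoidTwo ra rb | avoidTwo ca cb
... | r , r≢ra , r≢rb | c , c≢ca , c≢cb = (r , c) , reach
  where
  row-off : ∀ {i} → i ≢ ra → i ≢ rb → ∀ j → Off a b (i , j)
  row-off i≢ra i≢rb j = (λ e → i≢ra (cong proj₁ e)) , (λ e → i≢rb (cong proj₁ e))

  col-off : ∀ {j} → j ≢ ca → j ≢ cb → ∀ i → Off a b (i , j)
  col-off j≢ca j≢cb i = (λ e → j≢ca (cong proj₂ e)) , (λ e → j≢cb (cong proj₂ e))

  fromRow : ∀ {i} → i ≢ ra → i ≢ rb → ∀ j → Walk (Off a b) Adj (i , j) (r , c)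
  fromRow i≢ra i≢rb j =
    rowWalk _ (row-off i≢ra i≢rb) j c ◅◅ colWalk c (col-off c≢ca c≢cb) _ r

  fromCol : ∀ {j} → j ≢ ca → j ≢ cb → ∀ i → Walk (Off a b) Adj (i , j) (r , c)
  fromCol j≢ca j≢cb i =
    colWalk _ (col-off j≢ca j≢cb) i r ◅◅ rowWalk r (row-off r≢ra r≢rb) _ c

  reach : ∀ u → Off a b u → (∃ λ y → Adj u y × Off a b y) → Walk (Off a b) Adj u (r , c)
  reach (i , j) (u≢a , u≢b) ((i' , j') , uy , y≢a , y≢b)
    with i Fin.≟ ra | i Fin.≟ rb | j Fin.≟ ca | j Fin.≟ cb
  ... | no i≢ra | no i≢rb | _ | _ = fromRow i≢ra i≢rb j
  ... | _ | _ | no j≢ca | no j≢cb = fromCol j≢ca j≢cb i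
  ... | yes refl | _ | yes refl | _ = ⊥-elim (u≢a refl)
  ... | _ | yes refl | _ | yes refl = ⊥-elim (u≢b refl)
  ... | yes refl | no i≢rb | no j≢ca | yes refl = case uy
    where
    case : Adj (i , j) (i' , j') → _
    case (inj₁ (refl , cc)) = step (u≢a , u≢b) uy
      (fromCol (λ { refl → y≢a refl }) (λ { refl → Consec-irrefl cc refl }) i)
    case (inj₂ (refl , cc)) = step (u≢a , u≢b) uy
      (fromRow (λ { refl → Consec-irrefl cc refl }) (λ { refl → y≢b refl }) j)
  ... | no i≢ra | yes refl | yes refl | no j≢cb = case uy
    where
    case : Adj (i , j) (i' , j') → _
    case (inj₁ (refl , cc)) = step (u≢a , u≢b) uy
      (fromCol (λ { refl → Consec-irrefl cc refl }) (λ { refl → y≢b refl }) i)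
    case (inj₂ (refl , cc)) = step (u≢a , u≢b) uy
      (fromRow (λ { refl → y≢a refl }) (λ { refl → Consec-irrefl cc refl }) j)

-- If `u` and `v` each had a neighbour off `a` and `b`, both would reach the common hub.
separated⇒trapped : ∀ {p q} (a b u v : Node (3 + p) (3 + q)) → Off a b u → Off a b v →
  ¬ Walk (Off a b) Adj u v → ¬ ¬ (Trapped a b u ⊎ Trapped a b v)
separated⇒trapped a b u v offu offv ¬walk k with toHub a b
... | h , walkTo =
  ¬¬-excluded-middle {A = Escape u} λ
    { (no ¬eu) → k (inj₁ (trapped ¬eu))
    ; (yes eu) → ¬¬-excluded-middle {A = Escape v} λ
      { (no ¬ev) → k (inj₂ (trapped ¬ev))
      ; (yes ev) → ¬walk (walkTo u offu eu ◅◅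
                          walk-reverse (λ {x} {y} → Adj-sym {u = x} {y}) (walkTo v offv ev)) } }
  where
  Escape : Node _ _ → Set
  Escape x = ∃ λ y → Adj x y × Off a b y

  trapped : ∀ {x} → ¬ Escape x → Trapped a b x
  trapped ¬e y xy with y ≟ₙ a | y ≟ₙ b
  ... | yes y≡a | _       = inj₁ y≡a
  ... | no _    | yes y≡b = inj₂ y≡b
  ... | no y≢a  | no y≢b  = ⊥-elim (¬e (y , xy , y≢a , y≢b))

-- A vertical and a horizontal neighbour of `u` are distinct, so they are `a` and `b`; they differ
-- in both coordinates.
trapped⇒¬adj : ∀ {p q} {a b u : Node (2 + p) (2 + q)} → Trapped a b u → ¬ Adj a b
trapped⇒¬adj {u = i , j} tr ab
  with i' , ci ← neighbour i
  with j' , cj ← neighbour j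
  with tr (i , j') (inj₁ (refl , cj)) | tr (i' , j) (inj₂ (refl , ci))
... | inj₁ refl | inj₁ refl = Consec-irrefl ci refl
... | inj₂ refl | inj₂ refl = Consec-irrefl ci refl
... | inj₁ refl | inj₂ refl = [ (λ { (refl , _) → Consec-irrefl ci refl })
                              , (λ { (refl , _) → Consec-irrefl cj refl }) ]′ ab
... | inj₂ refl | inj₁ refl = [ (λ { (refl , _) → Consec-irrefl ci refl })
                              , (λ { (refl , _) → Consec-irrefl cj refl }) ]′ ab

-- Two of the three neighbours must coincide, and the vertical one differs from both horizontal
-- ones.
trapped⇒oneSided : ∀ {m n} {a b : Node m n} {i i' j j' l} → Trapped a b (i , j) →
  Consec i i' → Consec j j' → Consec j l → j' ≡ l
trapped⇒oneSided {i = i} {i'} {j} {j'} {l} tr ci cj cl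
  with tr (i' , j) (inj₂ (refl , ci)) | tr (i , j') (inj₁ (refl , cj)) | tr (i , l) (inj₁ (refl , cl))
... | _         | inj₁ refl | inj₁ refl = refl
... | _         | inj₂ refl | inj₂ refl = refl
... | inj₁ refl | inj₁ refl | inj₂ refl = ⊥-elim (Consec-irrefl ci refl)
... | inj₁ refl | inj₂ refl | inj₁ refl = ⊥-elim (Consec-irrefl ci refl)
... | inj₂ refl | inj₁ refl | inj₂ refl = ⊥-elim (Consec-irrefl ci refl)
... | inj₂ refl | inj₂ refl | inj₁ refl = ⊥-elim (Consec-irrefl ci refl)

oppositeCorner : ∀ {m n} {i i' : Fin m} {j j' : Fin n} (y : Node m n) →
  Consec i i' → Consec j j' → Adj y (i , j') → Adj y (i' , j) → y ≢ (i , j) → y ≡ (i' , j')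
oppositeCorner y ci cj (inj₁ (refl , _)) (inj₁ (refl , _)) y≢ = ⊥-elim (Consec-irrefl ci refl)
oppositeCorner y ci cj (inj₁ (refl , _)) (inj₂ (refl , _)) y≢ = ⊥-elim (y≢ refl)
oppositeCorner y ci cj (inj₂ (refl , _)) (inj₁ (refl , _)) y≢ = refl
oppositeCorner y ci cj (inj₂ (refl , _)) (inj₂ (refl , _)) y≢ = ⊥-elim (Consec-irrefl cj refl)

-- Otherwise y and (i , j) are opposite nodes of a square neither of which has a neighbour
-- outside that square, so the grid has only two columns.
trappedTwin : ∀ {p q} {a b c d y : Node (3 + p) (3 + q)} {i i' j j'} →
  Trapped a b (i , j) → Trapped c d y → Consec i i' → Consec j j' →
  Adj y (i , j') → Adj y (i' , j) → y ≡ (i , j)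
trappedTwin {y = y} {i} {i'} {j} {j'} tr tr' ci cj yh yg =
  decidable-stable (y ≟ₙ (i , j)) λ y≢ → absurd (oppositeCorner y ci cj yh yg y≢)
  where
  absurd : ¬ y ≡ (i' , j')
  absurd refl with thirdInLine {j = j} {j'} cj
  ... | inj₁ (l , cl , l≢j') =
    l≢j' (sym (trapped⇒oneSided {i = i} {i'} {j} {j'} {l} tr ci cj cl))
  ... | inj₂ (l , cl , l≢j) =
    l≢j (sym (trapped⇒oneSided {i = i'} {i} {j'} {j} {l} tr' (Sum.swap ci) (Sum.swap cj) cl))

-- Sorting three indices, and reachability along a walk.

noThree : (R : ℕ → Set) → (∀ {i j l} → i < j → j < l → R i → R j → R l → ⊥) →
  ∀ {i j l} → R i → R j → R l → i ≢ j → i ≢ l → j ≢ l → ⊥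
noThree R f {i} {j} {l} ri rj rl i≢j i≢l j≢l with <-cmp i j | <-cmp j l | <-cmp i l
... | tri≈ _ e _ | _          | _          = i≢j e
... | _          | tri≈ _ e _ | _          = j≢l e
... | _          | _          | tri≈ _ e _ = i≢l e
... | tri< a _ _ | tri< b _ _ | _          = f a b ri rj rl
... | tri< _ _ _ | tri> _ _ b | tri< c _ _ = f c b ri rl rj
... | tri< a _ _ | tri> _ _ _ | tri> _ _ c = f c a rl ri rj
... | tri> _ _ a | tri> _ _ b | _          = f b a rl rj ri
... | tri> _ _ a | tri< _ _ _ | tri< c _ _ = f a c rj ri rl
... | tri> _ _ _ | tri< b _ _ | tri> _ _ c = f b c rj rl ri

-- Each node of the walk is reached from `s` by a prefix. Hence the component of `s` is connected
-- within itself.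
walk-reachable : ∀ {A : Set} {P : A → Set} {R : A → A → Set} {s u v} →
  Walk P R s u → Walk P R u v → Walk (Walk P R s) R u v
walk-reachable a (here _)     = here a
walk-reachable a (step p r q) =
  step a r (walk-reachable (a ◅◅ step p r (here (walk-start q))) q)

-- Bypassed nodes of a minimum connector.

module _ {p q : ℕ} (w : Node (3 + p) (3 + q) → ℕ) (0<w : ∀ x → 0 < w x)
         {s t : Node (3 + p) (3 + q)} (¬cut : ¬ TwoCut s t)
         (B : Subgraph (3 + p) (3 + q)) (minimum : IsMinNSC w s t B)
         (path : SimplePath (InV B) (EdgeOf B) s t) where

  private
    G : Set
    G = Node (3 + p) (3 + q)

    connB : SubConnected B
    connB = proj₁ (proj₁ minimum)

    s∈B : InV B s
    s∈B = proj₁ (proj₂ (proj₁ minimum))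

    t∈B : InV B t
    t∈B = proj₁ (proj₂ (proj₂ (proj₁ minimum)))

    connC : RestConnected (V B)
    connC = proj₁ (proj₂ (proj₂ (proj₂ (proj₁ minimum))))

    c₀ : G
    c₀ = proj₁ (proj₂ (proj₂ (proj₂ (proj₂ (proj₁ minimum)))))

    c₀∉B : Outside (V B) c₀
    c₀∉B = proj₂ (proj₂ (proj₂ (proj₂ (proj₂ (proj₁ minimum)))))

    in-out : ∀ {x} → InV B x → ¬ Outside (V B) x
    in-out x∈B x∉B with () ← trans (sym x∈B) x∉B

    symG : ∀ {u v : G} → Adj u v → Adj v u
    symG {u} {v} = Adj-sym {u = u} {v}

  Avoiding : G → G → Set
  Avoiding z x = InV B x × x ≢ z

  -- The walk uses `Adj` rather than the edges of `B`: weight depends on nodes only, and the lighter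
  -- competitor will be an induced subgraph. Chords missing from `B` are therefore allowed.
  Bypassed : G → Set
  Bypassed z = InV B z × z ≢ s × z ≢ t × Walk (Avoiding z) Adj s t

  -- Otherwise the component of s in B - z is a lighter connector, as z joins everything
  -- else to the complement of B.
  bypassed⇒enclosed : ∀ {z} → Bypassed z → ∀ c → Adj z c → ¬ Outside (V B) c
  bypassed⇒enclosed {z} (z∈B , z≢s , z≢t , s⇝t) c zc c∉B = ¬¬-decide Reach lighter
    where
    Reach : G → Set
    Reach = Walk (Avoiding z) Adj s

    reachS : Reach s
    reachS = here (s∈B , λ e → z≢s (sym e))

    lighter : ¬ (∀ x → Dec (Reach x))
    lighter reach? = <⇒≱
      (weightOf-mono-< w X (V B) (λ x e → proj₁ (walk-end (does-true (reach? x) e)))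
        z z∉X z∈B (0<w z))
      (proj₂ minimum B' (connB' , dec-true (reach? s) reachS , dec-true (reach? t) s⇝t
                        , connC' , z , z∉X))
      where
      B' : Subgraph (3 + p) (3 + q)
      B' = induced reach?

      X : G → Bool
      X = V B'

      z∉X : X z ≡ false
      z∉X = dec-false (reach? z) λ r → proj₂ (walk-end r) refl

      fromS : ∀ {x} → Reach x → Walk (InV B') (EdgeOf B') s x
      fromS r = walk-map (λ x → x) (λ {u} → dec-true (reach? u))
        (λ {u} {v} ru rv uv → dec-true (reach? u ×-dec reach? v ×-dec Adj? u v) (ru , rv , uv))
        (walk-reachable reachS r)

      connB' : SubConnected B'
      connB' u v u∈X v∈X =
        walk-reverse (λ {x} {y} → E-sym B' x y) (fromS (does-true (reach? u) u∈X))
          ◅◅ fromS (does-true (reach? v) v∈X)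

      -- Before meeting `z`, the walk cannot enter the component of `s`, since reversing that edge
      -- would put the previous node in the component too.
      B⇝z : ∀ {x} → Walk (InV B) (EdgeOf B) x z → ¬ Reach x → Walk (Outside X) Adj x z
      B⇝z (here _) ¬r = here (dec-false (reach? _) ¬r)
      B⇝z {x} (step {v = y} x∈B xy rest) ¬rx with x ≟ₙ z
      ... | yes refl = here z∉X
      ... | no x≢z = step (dec-false (reach? x) ¬rx) (E-adj B x y xy)
        (B⇝z rest λ ry → ¬rx (ry ◅◅ step (walk-end ry) (symG {x} {y} (E-adj B x y xy))
                                      (here (x∈B , x≢z))))

      toZ : ∀ x → Outside X x → Walk (Outside X) Adj x z
      toZ x x∉X with V B x in eq
      ... | true  = B⇝z (connB x z eq z∈B) λ r → true≢false (trans (sym (dec-true (reach? x) r)) x∉X)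
        where
        true≢false : true ≢ false
        true≢false ()
      ... | false =
        walk-map (λ y → y) outside (λ _ _ r → r) (connC x c eq c∉B)
          ◅◅ step (outside c∉B) (symG {z} {c} zc) (here z∉X)
        where
        outside : ∀ {y} → Outside (V B) y → Outside X y
        outside y∉B = dec-false (reach? _) λ r → in-out (proj₁ (walk-end r)) y∉B

      connC' : RestConnected X
      connC' u v u∉X v∉X =
        toZ u u∉X ◅◅ walk-reverse (λ {x} {y} → symG {x} {y}) (toZ v v∉X)

  bypassed⇒neighbours∈B : ∀ {z} → Bypassed z → ∀ y → Adj z y → InV B y
  bypassed⇒neighbours∈B bz y zy with V B y in eq
  ... | true  = refl
  ... | false = ⊥-elim (bypassed⇒enclosed bz y zy eq)

  -- Detours around nodes of the fixed path.

  open SimplePath path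

  OnPath : G → Set
  OnPath y = ∃ λ i → i < suc len × at i ≡ y

  onPath? : ∀ y → Dec (OnPath y)
  onPath? y = anyUpTo? (λ i → at i ≟ₙ y) (suc len)

  adj-at : ∀ {i} → i < len → Adj (at i) (at (suc i))
  adj-at {i} i<len = E-adj B (at i) (at (suc i)) (edge i<len)

  segment : ∀ {z i j} → i ≤′ j → j ≤ len → (∀ l → i ≤ l → l ≤ j → at l ≢ z) →
    Walk (Avoiding z) Adj (at i) (at j)
  segment ≤′-refl j≤len avoid = here (inside j≤len , avoid _ ≤-refl ≤-refl)
  segment (≤′-step {j} i≤j) j<len avoid =
    segment i≤j (<⇒≤ j<len) (λ l i≤l l≤j → avoid l i≤l (m≤n⇒m≤1+n l≤j))
      ◅◅ step (inside (<⇒≤ j<len) , avoid j (≤′⇒≤ i≤j) (n≤1+n j)) (adj-at j<len)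
           (here (inside j<len , avoid (suc j) (m≤n⇒m≤1+n (≤′⇒≤ i≤j)) ≤-refl))

  -- The detour joins the path up to `at i` to the path from `at j`. Injectivity keeps both pieces
  -- off `at l` and separates `at l` from `s` and `t`.
  bypass : ∀ {i l j} → i < l → l < j → j ≤ len →
    Walk (Avoiding (at l)) Adj (at i) (at j) → Bypassed (at l)
  bypass {i} {l} {j} i<l l<j j≤len detour =
    inside l≤len ,
    (λ e → m<n⇒n≢0 i<l (inj l≤len z≤n (trans e (sym first)))) ,
    (λ e → <⇒≢ (<-≤-trans l<j j≤len) (inj l≤len ≤-refl (trans e (sym last)))) ,
    subst₂ (Walk (Avoiding (at l)) Adj) first last
      (segment (≤⇒≤′ z≤n) i≤len (λ h _ h≤i e → <⇒≢ (≤-<-trans h≤i i<l) (inj (≤-trans h≤i i≤len) l≤len e))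
       ◅◅ detour ◅◅
       segment (≤⇒≤′ j≤len) ≤-refl (λ h j≤h h≤len e → >⇒≢ (<-≤-trans l<j j≤h) (inj h≤len l≤len e)))
    where
    l≤len : l ≤ len
    l≤len = ≤-trans (<⇒≤ l<j) j≤len
    i≤len : i ≤ len
    i≤len = ≤-trans (<⇒≤ i<l) l≤len

  -- The path itself is a walk avoiding `y`.
  offPath⇒bypassed : ∀ {y} → InV B y → ¬ OnPath y → Bypassed y
  offPath⇒bypassed y∈B ∉P =
    y∈B , (λ { refl → ∉P (0 , s≤s z≤n , first) }) , (λ { refl → ∉P (len , ≤-refl , last) }) ,
    subst₂ (Walk (Avoiding _) Adj) first last
      (segment (≤⇒≤′ z≤n) ≤-refl λ l _ l≤len e → ∉P (l , s≤s l≤len , e))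

  unbypassed⇒onPath : ∀ {y} → InV B y → ¬ Bypassed y → OnPath y
  unbypassed⇒onPath {y} y∈B ¬by =
    decidable-stable (onPath? y) λ ∉P → ¬by (offPath⇒bypassed y∈B ∉P)

  at≢ : ∀ {i j} → i ≤ len → j ≤ len → i ≢ j → at i ≢ at j
  at≢ i≤ j≤ i≢j e = i≢j (inj i≤ j≤ e)

  -- Components of bypassed nodes and their neighbours.

  -- For bypassed `v`, these are the nodes adjacent to its component of bypassed nodes, without
  -- belonging to it.
  Attached : G → G → Set
  Attached v y = ¬ Bypassed y × ∃ λ u → Walk Bypassed Adj v u × Adj u y

  attached∈B : ∀ {v y} → Attached v y → InV B y
  attached∈B (_ , _ , r , uy) = bypassed⇒neighbours∈B (walk-end r) _ uy

  -- Being unbypassed, all three lie on the path and can be ordered by index, which singles out a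
  -- middle one.
  attached-noThree : ∀ {v a b c} → Attached v a → Attached v b → Attached v c →
    a ≢ b → a ≢ c → b ≢ c → ⊥
  attached-noThree {v} Aa Ab Ac a≢b a≢c b≢c
    with unbypassed⇒onPath (attached∈B Aa) (proj₁ Aa)
       | unbypassed⇒onPath (attached∈B Ab) (proj₁ Ab)
       | unbypassed⇒onPath (attached∈B Ac) (proj₁ Ac)
  ... | i , i≤ , refl | j , j≤ , refl | l , l≤ , refl =
    noThree (λ i → i < suc len × Attached v (at i)) between (i≤ , Aa) (j≤ , Ab) (l≤ , Ac)
      (λ { refl → a≢b refl }) (λ { refl → a≢c refl }) (λ { refl → b≢c refl })
    where
    between : ∀ {i j l} → i < j → j < l → i < suc len × Attached v (at i) →
      j < suc len × Attached v (at j) → l < suc len × Attached v (at l) → ⊥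
    between {i} {j} {l} i<j j<l (i≤ , Ai@(_ , u , v⇝u , ui)) (j≤ , ¬bj , _)
            (l≤ , Al@(_ , u' , v⇝u' , ul)) =
      -- The detour leaves `at i` for `u`, passes through `v` to `u'` and returns at `at l`. Its
      -- inner nodes are bypassed, hence differ from `at j`.
      ¬bj (bypass i<j j<l (s≤s⁻¹ l≤)
        (step (attached∈B Ai , at≢ (s≤s⁻¹ i≤) (s≤s⁻¹ j≤) (<⇒≢ i<j)) (symG {u} {at i} ui)
          (walk-reverse (λ {x} {y} → symG {x} {y}) (weaken v⇝u) ◅◅ weaken v⇝u'
           ◅◅ step (weaken-node (walk-end v⇝u')) ul
                (here (attached∈B Al , at≢ (s≤s⁻¹ l≤) (s≤s⁻¹ j≤) (>⇒≢ j<l))))))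
      where
      weaken-node : ∀ {x} → Bypassed x → Avoiding (at j) x
      weaken-node bx = proj₁ bx , λ { refl → ¬bj bx }
      weaken : ∀ {x y} → Walk Bypassed Adj x y → Walk (Avoiding (at j)) Adj x y
      weaken = walk-map (λ x → x) weaken-node (λ _ _ r → r)

  -- Otherwise `c₀` has all its neighbours in `B` and is the whole complement. Its neighbours turn
  -- out to be terminals, so deleting `s` and `t` would cut `c₀` off from `v`.
  complementNotCorner : ∀ {v a b} → Bypassed v → InV B a → InV B b → ¬ Bypassed a → ¬ Bypassed b →
    ¬ Trapped a b c₀
  complementNotCorner {v} {a} {b} (v∈B , v≢s , v≢t , _) a∈B b∈B ¬ba ¬bb tr = ¬cut isolated
    where
    ab∈B : ∀ {y} → y ≡ a ⊎ y ≡ b → InV B y × ¬ Bypassed y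
    ab∈B (inj₁ refl) = a∈B , ¬ba
    ab∈B (inj₂ refl) = b∈B , ¬bb

    c₀-only : ∀ {x} → Outside (V B) x → x ≡ c₀
    c₀-only {x} x∉B with connC c₀ x c₀∉B x∉B
    ... | here _ = refl
    ... | step {v = y} _ c₀y rest = ⊥-elim (in-out (proj₁ (ab∈B (tr y c₀y))) (walk-start rest))

    ≢c₀⇒∈B : ∀ {x} → x ≢ c₀ → InV B x
    ≢c₀⇒∈B {x} x≢c₀ with V B x in eq
    ... | true  = refl
    ... | false = ⊥-elim (x≢c₀ (c₀-only eq))

    ∈B⇒≢c₀ : ∀ {x} → InV B x → x ≢ c₀
    ∈B⇒≢c₀ x∈B refl = in-out x∈B c₀∉B

    terminal : ∀ y → Adj c₀ y → y ≡ s ⊎ y ≡ t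
    terminal y c₀y with y ≟ₙ s | y ≟ₙ t
    ... | yes e | _     = inj₁ e
    ... | no _  | yes e = inj₂ e
    -- Walks avoiding `c₀` and `y` stay in `B` without `y`. As `y` is unbypassed, `c₀` and `y`
    -- separate `s` from `t`, so one terminal is trapped by this pair; but the pair is adjacent.
    ... | no y≢s | no y≢t with ab∈B (tr y c₀y)
    ... | y∈B , ¬by = ⊥-elim
      (separated⇒trapped c₀ y s t (∈B⇒≢c₀ s∈B , λ e → y≢s (sym e)) (∈B⇒≢c₀ t∈B , λ e → y≢t (sym e))
        (λ s⇝t → ¬by (y∈B , y≢s , y≢t , walk-map (λ x → x)
          (λ { (x≢c₀ , x≢y) → ≢c₀⇒∈B x≢c₀ , x≢y }) (λ _ _ r → r) s⇝t))
        [ (λ trs → trapped⇒¬adj {a = c₀} {y} {s} trs c₀y)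
        , (λ trt → trapped⇒¬adj {a = c₀} {y} {t} trt c₀y) ]′)

    isolated : TwoCut s t
    isolated conn
      with conn c₀ v ((λ e → ∈B⇒≢c₀ s∈B (sym e)) , λ e → ∈B⇒≢c₀ t∈B (sym e)) (v≢s , v≢t)
    ... | here _ = ∈B⇒≢c₀ v∈B refl
    ... | step {v = y} _ c₀y rest = [ proj₁ (walk-start rest) , proj₂ (walk-start rest) ]′ (terminal y c₀y)

  -- At most two nodes are attached to the component of `v`, and they separate `v` from `c₀`. So `v`
  -- or `c₀` is trapped, and `c₀` is ruled out by `complementNotCorner`.
  bypassed⇒trapped : ∀ {v} → Bypassed v → ¬ ¬ (∃₂ λ a b → ¬ Bypassed a × ¬ Bypassed b × Trapped a b v)
  bypassed⇒trapped {v} bv k =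
    ¬¬-atMostTwo (Attached v) _≟ₙ_ {S = λ y → InV B y × ¬ Bypassed y}
      -- `s` is the padding: it is in `B` and never bypassed.
      (s∈B , λ bs → proj₁ (proj₂ bs) refl) (λ Ay → attached∈B Ay , proj₁ Ay) attached-noThree cutPair
    where
    cutPair : ¬ (∃₂ λ a b → (InV B a × ¬ Bypassed a) × (InV B b × ¬ Bypassed b) ×
                              (∀ y → Attached v y → y ≡ a ⊎ y ≡ b))
    cutPair (a , b , (a∈B , ¬ba) , (b∈B , ¬bb) , cover) =
      separated⇒trapped a b v c₀
        ((λ { refl → ¬ba bv }) , (λ { refl → ¬bb bv }))
        ((λ { refl → in-out a∈B c₀∉B }) , (λ { refl → in-out b∈B c₀∉B }))
        (λ v⇝c₀ → confined v⇝c₀ (here bv))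
        [ (λ tr → k (a , b , ¬ba , ¬bb , tr)) , complementNotCorner bv a∈B b∈B ¬ba ¬bb ]′
      where
      -- The first unbypassed node on a walk out of the component is attached, so it is `a` or `b`;
      -- a walk off both never leaves the component.
      confined : ∀ {x} → Walk (Off a b) Adj x c₀ → ¬ Walk Bypassed Adj v x
      confined (here _) v⇝c₀ = in-out (proj₁ (walk-end v⇝c₀)) c₀∉B
      confined {x} (step {v = y} _ xy rest) v⇝x = ¬¬-excluded-middle {A = Bypassed y} λ where
        (yes by) → confined rest (v⇝x ◅◅ step (walk-end v⇝x) xy (here by))
        (no ¬by) → [ proj₁ (walk-start rest) , proj₂ (walk-start rest) ]′
                     (cover y (¬by , x , v⇝x , xy))

  bypassed⇒¬bypassed : ∀ {u v} → Bypassed u → Adj u v → ¬ Bypassed v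
  bypassed⇒¬bypassed {u} {v} bu uv bv = bypassed⇒trapped bu λ where
    (a , b , ¬ba , ¬bb , tr) → [ (λ { refl → ¬ba bv }) , (λ { refl → ¬bb bv }) ]′ (tr v uv)

  -- Chords of the path and nodes off it.

  -- A longer gap would contain two adjacent bypassed nodes.
  shortGap : ∀ {i j} → suc i < j → j ≤ len → (∀ l → i < l → l < j → Bypassed (at l)) → j ≡ 2 + i
  shortGap {i} {j} i+1<j j≤len by = decidable-stable (j ≟ 2 + i) λ j≢ →
    let 2+i<j = ≤∧≢⇒< i+1<j (λ e → j≢ (sym e)) in
    bypassed⇒¬bypassed (by (suc i) ≤-refl i+1<j) (adj-at (≤-trans i+1<j j≤len))
      (by (2 + i) (n≤1+n _) 2+i<j)

  -- Abstract, since otherwise the with-abstractions below normalise this proof.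
  abstract
    noChord : ∀ {i j} → i < j → j ≤ len → Adj (at i) (at j) → suc i ≡ j
    noChord {i} {j} i<j j≤len ij = decidable-stable (suc i ≟ j) λ i+1≢j →
      let i+1<j = ≤∧≢⇒< i<j i+1≢j in
      -- The chord bypasses every node between its ends, so there is just one, and it forms a
      -- triangle with them.
      impossible (shortGap i+1<j j≤len λ l i<l l<j → bypass i<l l<j j≤len
        (let l≤len = ≤-trans (<⇒≤ l<j) j≤len ; i≤len = ≤-trans (<⇒≤ i<l) l≤len in
         step (inside i≤len , at≢ i≤len l≤len (<⇒≢ i<l)) ij
           (here (inside j≤len , at≢ j≤len l≤len (>⇒≢ l<j)))))
      where
      impossible : ¬ (j ≡ 2 + i)
      impossible refl = noTriangle (at i) (at (suc i)) (at (2 + i))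
        (adj-at (≤-trans (n≤1+n _) j≤len)) (adj-at j≤len) ij

  -- The detour through `v` bypasses everything between `at i` and `at j`. There is such a node
  -- because grids have no triangle, and only one by `shortGap`.
  twin : ∀ {v i j} → i < j → j ≤ len → InV B v → ¬ OnPath v → Adj v (at i) → Adj v (at j) →
    ∃ λ y → Bypassed y × y ≢ v × Adj y (at i) × Adj y (at j)
  twin {v} {i} {j} i<j j≤len v∈B v∉P vi vj = at (suc i) , found
    where
    i+1<j : suc i < j
    i+1<j = ≤∧≢⇒< i<j λ { refl → noTriangle v (at i) (at j) vi (adj-at j≤len) vj }

    by : ∀ l → i < l → l < j → Bypassed (at l)
    by l i<l l<j = bypass i<l l<j j≤len
      (step (inside i≤len , at≢ i≤len l≤len (<⇒≢ i<l)) (symG {v} {at i} vi)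
        (step (v∈B , λ e → v∉P (l , s≤s l≤len , sym e)) vj
          (here (inside j≤len , at≢ j≤len l≤len (>⇒≢ l<j)))))
      where
      l≤len : l ≤ len
      l≤len = ≤-trans (<⇒≤ l<j) j≤len
      i≤len : i ≤ len
      i≤len = ≤-trans (<⇒≤ i<l) l≤len

    found : Bypassed (at (suc i)) × at (suc i) ≢ v × Adj (at (suc i)) (at i) × Adj (at (suc i)) (at j)
    found = by (suc i) ≤-refl i+1<j
          , (λ e → v∉P (suc i , s≤s (≤-trans i<j j≤len) , e))
          , symG {at i} {at (suc i)} (adj-at (≤-trans i<j j≤len))
          , subst (λ h → Adj (at (suc i)) (at h)) (sym (shortGap i+1<j j≤len by))
              (adj-at (≤-trans i+1<j j≤len))

  twinOf : ∀ {v h g} → InV B v → ¬ OnPath v → Adj v h → Adj v g → h ≢ g →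
    OnPath h → OnPath g → ∃ λ y → Bypassed y × y ≢ v × Adj y h × Adj y g
  twinOf v∈B v∉P vh vg h≢g (a , a≤ , refl) (b , b≤ , refl) with <-cmp a b
  ... | tri≈ _ refl _ = ⊥-elim (h≢g refl)
  ... | tri< a<b _ _  = twin a<b (s≤s⁻¹ b≤) v∈B v∉P vh vg
  ... | tri> _ _ b<a  =
    let (y , by , y≢v , yg , yh) = twin b<a (s≤s⁻¹ a≤) v∈B v∉P vg vh in y , by , y≢v , yh , yg

  abstract
    -- A node `v` off the path is bypassed, so its neighbours are unbypassed and lie on the path. A
    -- horizontal and a vertical one yield a bypassed twin of `v`; both being trapped, `trappedTwin`
    -- identifies them.
    covered : ∀ v → InV B v → OnPath v
    covered v@(i , j) v∈B = decidable-stable (onPath? v) offPath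
      where
      offPath : ¬ ¬ OnPath v
      offPath v∉P = contradict (neighbour i) (neighbour j)
        where
        bv : Bypassed v
        bv = offPath⇒bypassed v∈B v∉P

        onP : ∀ y → Adj v y → OnPath y
        onP y vy = unbypassed⇒onPath (bypassed⇒neighbours∈B bv y vy) (bypassed⇒¬bypassed bv vy)

        contradict : ∃ (Consec i) → ¬ ∃ (Consec j)
        contradict (i' , ci) (j' , cj) =
          let vh = inj₁ (refl , cj)
              vg = inj₂ (refl , ci)
              (y , by , y≢v , yh , yg) =
                twinOf {v} {i , j'} {i' , j} v∈B v∉P vh vg (λ e → Consec-irrefl ci (cong proj₁ e))
                  (onP (i , j') vh) (onP (i' , j) vg)
          in bypassed⇒trapped bv λ { (_ , _ , _ , _ , tr) →
             bypassed⇒trapped by λ { (_ , _ , _ , _ , tr') →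
             y≢v (trappedTwin tr tr' ci cj yh yg) } }

  -- The connector coincides with the path.

  consecutive : ∀ {u v} → InV B u → InV B v → Adj u v →
    ∃ λ i → i < len × ((at i ≡ u × at (suc i) ≡ v) ⊎ (at i ≡ v × at (suc i) ≡ u))
  consecutive {u} {v} u∈B v∈B uv with covered u u∈B | covered v v∈B
  ... | i , i≤ , refl | j , j≤ , refl with <-cmp i j
  ... | tri≈ _ refl _ = ⊥-elim (Adj-irrefl {u = at i} {at i} uv refl)
  ... | tri< i<j _ _ with refl ← noChord i<j (s≤s⁻¹ j≤) uv = i , s≤s⁻¹ j≤ , inj₁ (refl , refl)
  ... | tri> _ _ j<i with refl ← noChord j<i (s≤s⁻¹ i≤) (symG {at i} {at j} uv) =
    j , s≤s⁻¹ i≤ , inj₂ (refl , refl)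

  isPath : IsPath s t B
  isPath = len , (λ i → at (toℕ i))
    , (λ {i} {j} e → toℕ-injective (inj (s≤s⁻¹ (toℕ<n i)) (s≤s⁻¹ (toℕ<n j)) e))
    , first , trans (cong at (toℕ-fromℕ len)) last
    , (λ u u∈B → let (i , i≤ , e) = covered u u∈B in
                 Fin.fromℕ< i≤ , trans (cong at (toℕ-fromℕ< i≤)) e)
    , (λ i → inside (s≤s⁻¹ (toℕ<n i)))
    , pathEdge
    , (λ i → subst (λ h → EdgeOf B (at h) (at (suc (toℕ i)))) (sym (toℕ-inject₁ i)) (edge (toℕ<n i)))
    where
    pathEdge : ∀ u v → EdgeOf B u v → Σ (Fin len) λ i →
      (at (toℕ (inject₁ i)) ≡ u × at (suc (toℕ i)) ≡ v) ⊎ (at (toℕ (inject₁ i)) ≡ v × at (suc (toℕ i)) ≡ u)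
    pathEdge u v uv with E-V B u v uv
    ... | u∈B , v∈B with consecutive u∈B v∈B (E-adj B u v uv)
    ... | i , i<len , e rewrite sym (toℕ-fromℕ< i<len) = Fin.fromℕ< i<len ,
      subst (λ h → (at h ≡ u × at (suc (toℕ (Fin.fromℕ< i<len))) ≡ v) ⊎ (at h ≡ v × at (suc (toℕ (Fin.fromℕ< i<len))) ≡ u))
        (sym (toℕ-inject₁ (Fin.fromℕ< i<len))) e

  isInduced : IsInduced B
  isInduced u v u∈B v∈B uv with consecutive u∈B v∈B uv
  ... | i , i<len , inj₁ (refl , refl) = edge i<len
  ... | i , i<len , inj₂ (refl , refl) = E-sym B v u (edge i<len)

theorem1 : (m n : ℕ) → 3 ≤ m → 3 ≤ n
    → (w : Node m n → ℕ) → (∀ x → 0 < w x)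
    → (s t : Node m n) → s ≢ t → ¬ TwoCut s t
    → (B : Subgraph m n) → IsMinNSC w s t B
    → IsPath s t B × IsInduced B × NonSeparating B
theorem1 (suc (suc (suc _))) (suc (suc (suc _))) (s≤s (s≤s (s≤s _))) (s≤s (s≤s (s≤s _)))
  w 0<w s t _ ¬cut B minimum@((connB , s∈B , t∈B , connC , _) , _) =
  isPath w 0<w ¬cut B minimum path , isInduced w 0<w ¬cut B minimum path , connC
  where
  path : SimplePath (InV B) (EdgeOf B) s t
  -- Any simple `st`-path of `B` will do, since each one exhausts `B`.
  path = loopErase _≟ₙ_ (connB s t s∈B t∈B)
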